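{- Let $H_0, H_1, \ldots, H_{n-1}$ be a sort signature, i.e.\ a list in which each $H_i$ is a functor $H_i : \mathcal{C}_i \Rightarrow \mathsf{Set}$, where $\mathcal{C}_0$ is the terminal category and $\mathcal{C}_{i+1}$ is obtained from $\mathcal{C}_i$ and $H_i$ as described in the context. Then the base category $\mathcal{C}_n$ has all small limits.
   Context: The ambient framework is Martin-Löf type theory with function extensionality; $\mathsf{Set}$ denotes a universe of types satisfying uniqueness of identity proofs (sets), and also the category of sets and functions. Categories are precategories in the sense of the HoTT book. Given a category $\mathcal{C}_i$ and a functor $H_i : \mathcal{C}_i \Rightarrow \mathsf{Set}$, the category $\mathcal{C}_{i+1}$ has as objects pairs $(X,P)$ with $X$ an object of $\mathcal{C}_i$ and $P : H_i(X) \to \mathsf{Set}$ a family of sets; a morphism $(f,g) : (X,P) \to (Y,Q)$ consists of a morphism $f : X \to Y$ in $\mathcal{C}_i$ and a dependent function $g : (x : H_i(X)) \to P(x) \to Q(H_i(f)\,x)$. The category $\mathcal{C}_0$ is the terminal category (one object, one morphism). $\mathcal{C}_n$ is called the base category of the signature. A small limit is a limit of a diagram $D : \mathcal{I} \to \mathcal{C}$ whose shape category $\mathcal{I}$ has a set of objects and hom-sets that are sets. -}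

{-# OPTIONS --with-K #-}

-- Axiom K is on, so every type satisfies uniqueness of identity proofs:
-- each universe `Set ℓ` is a universe of sets, and the hom-types of a
-- precategory (as well as the objects of a diagram shape) are automatically
-- sets.  Function extensionality is an explicit parameter `fe`; it is
-- already needed for the category laws of `Extend`.

module Defs where

open import Level using (Level; _⊔_) renaming (suc to lsuc)
open import Axiom.Extensionality.Propositional using (Extensionality)
open import Data.Nat.Base using (ℕ; zero; suc)
open import Data.Product.Base using (Σ-syntax; _,_; proj₁; proj₂)
open import Data.Unit.Polymorphic.Base using (⊤; tt)
open import Relation.Binary.PropositionalEquality using (_≡_; refl; sym; cong; cong-app; subst)
open import Relation.Binary.HeterogeneousEquality as HEq using (_≅_; ≡-to-≅; ≅-to-≡)

record Precategory (o h : Level) : Set (lsuc (o ⊔ h)) where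
  infixr 9 _∘_
  field
    Obj   : Set o
    Hom   : Obj → Obj → Set h
    id    : ∀ {A} → Hom A A
    _∘_   : ∀ {A B C} → Hom B C → Hom A B → Hom A C
    idˡ   : ∀ {A B} (f : Hom A B) → id ∘ f ≡ f
    idʳ   : ∀ {A B} (f : Hom A B) → f ∘ id ≡ f
    assoc : ∀ {A B C D} (f : Hom A B) (g : Hom B C) (h : Hom C D) →
            (h ∘ g) ∘ f ≡ h ∘ (g ∘ f)

record Functor {o h o′ h′ : Level} (C : Precategory o h) (D : Precategory o′ h′) :
               Set (o ⊔ h ⊔ o′ ⊔ h′) where
  private
    module C = Precategory C
    module D = Precategory D
  field
    F₀   : C.Obj → D.Obj
    F₁   : ∀ {A B} → C.Hom A B → D.Hom (F₀ A) (F₀ B)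
    F-id : ∀ {A} → F₁ (C.id {A}) ≡ D.id
    F-∘  : ∀ {A B E} (f : C.Hom A B) (g : C.Hom B E) →
           F₁ (g C.∘ f) ≡ F₁ g D.∘ F₁ f

module _ {o h o′ h′ : Level} {I : Precategory o h} {C : Precategory o′ h′}
         (D : Functor I C) where
  private
    module I = Precategory I
    module C = Precategory C
    module D = Functor D

  record Cone : Set (o ⊔ h ⊔ o′ ⊔ h′) where
    field
      apex    : C.Obj
      π       : (i : I.Obj) → C.Hom apex (D.F₀ i)
      commute : ∀ {i j} (a : I.Hom i j) → D.F₁ a C.∘ π i ≡ π j

  record Limit : Set (o ⊔ h ⊔ o′ ⊔ h′) where
    field
      cone : Cone
    open Cone cone public
    field
      mediate : (K : Cone) → C.Hom (Cone.apex K) apex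
      factor  : (K : Cone) (i : I.Obj) → π i C.∘ mediate K ≡ Cone.π K i
      unique  : (K : Cone) (u : C.Hom (Cone.apex K) apex) →
                (∀ i → π i C.∘ u ≡ Cone.π K i) → u ≡ mediate K

HasLimitsOfSize : ∀ {o h} (ℓ : Level) → Precategory o h → Set (o ⊔ h ⊔ lsuc ℓ)
HasLimitsOfSize ℓ C = (I : Precategory ℓ ℓ) (D : Functor I C) → Limit D

Terminal : ∀ {o h} → Precategory o h
Terminal = record
  { Obj = ⊤ ; Hom = λ _ _ → ⊤ ; id = tt ; _∘_ = λ _ _ → tt
  ; idˡ = λ _ → refl ; idʳ = λ _ → refl ; assoc = λ _ _ _ → refl }

Sets : (ℓ : Level) → Precategory (lsuc ℓ) ℓ
Sets ℓ = record
  { Obj = Set ℓ ; Hom = λ A B → A → B ; id = λ x → x ; _∘_ = λ g f x → g (f x)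
  ; idˡ = λ _ → refl ; idʳ = λ _ → refl ; assoc = λ _ _ _ → refl }

module _ {ℓ : Level} (fe : Extensionality ℓ ℓ) where

  module _ (C : Precategory (lsuc ℓ) ℓ) (H : Functor C (Sets ℓ)) where
    private
      module C = Precategory C
      open Functor H renaming (F₀ to H₀; F₁ to H₁; F-id to H-id; F-∘ to H-∘)

    ExtObj : Set (lsuc ℓ)
    ExtObj = Σ[ X ∈ C.Obj ] (H₀ X → Set ℓ)

    ExtHom : ExtObj → ExtObj → Set ℓ
    ExtHom (X , P) (Y , Q) = Σ[ f ∈ C.Hom X Y ] ((x : H₀ X) → P x → Q (H₁ f x))

    -- Since H preserves identities and composition only up to ≡, the second
    -- components of identities and composites are transported along H-id, H-∘.
    extId : ∀ {A} → ExtHom A A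
    extId {X , P} = C.id , λ x p → subst P (sym (cong-app H-id x)) p

    extComp : ∀ {A B E} → ExtHom B E → ExtHom A B → ExtHom A E
    extComp {E = _ , R} (g , g′) (f , f′) =
      g C.∘ f , λ x p → subst R (sym (cong-app (H-∘ f g) x)) (g′ (H₁ f x) (f′ x p))

    ExtHom-≡ : ∀ {A B} {f f′ : ExtHom A B} → proj₁ f ≡ proj₁ f′ →
               (∀ x p → proj₂ f x p ≅ proj₂ f′ x p) → f ≡ f′
    ExtHom-≡ {f = f , _} refl e = cong (f ,_) (fe λ x → fe λ p → ≅-to-≡ (e x p))

    private
      removable : (A : ExtObj) {x y : H₀ (proj₁ A)} (e : x ≡ y) (p : proj₂ A x) →
                  subst (proj₂ A) e p ≅ p
      removable A = HEq.≡-subst-removable (proj₂ A)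

    Extend : Precategory (lsuc ℓ) ℓ
    Extend = record
      { Obj = ExtObj
      ; Hom = ExtHom
      ; id  = λ {A} → extId {A}
      ; _∘_ = λ {A} {B} {E} → extComp {A} {B} {E}
      ; idˡ = λ {A} {B} (f , f′) → ExtHom-≡ {A} {B} (C.idˡ f) λ x p →
          HEq.trans (removable B (sym (cong-app (H-∘ f C.id) x)) _)
                    (removable B (sym (cong-app H-id (H₁ f x))) (f′ x p))
      ; idʳ = λ {A} {B} (f , f′) → ExtHom-≡ {A} {B} (C.idʳ f) λ x p →
          HEq.trans (removable B (sym (cong-app (H-∘ C.id f) x)) _)
                    (HEq.cong₂ f′ (≡-to-≅ (cong-app H-id x))
                                  (removable A (sym (cong-app H-id x)) p))
      ; assoc = λ {A} {B} {E} {G} (f , f′) (g , g′) (h , h′) →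
          ExtHom-≡ {A} {G} (C.assoc f g h) λ x p →
          HEq.trans
            (HEq.trans (removable G (sym (cong-app (H-∘ f (h C.∘ g)) x)) _)
                       (removable G (sym (cong-app (H-∘ g h) (H₁ f x))) _))
            (HEq.sym
              (HEq.trans (removable G (sym (cong-app (H-∘ (g C.∘ f) h) x)) _)
                         (HEq.cong₂ h′ (≡-to-≅ (cong-app (H-∘ f g) x))
                                       (removable E (sym (cong-app (H-∘ f g) x))
                                                    (g′ (H₁ f x) (f′ x p))))))
      }

  -- SortSignature n is the type of lists H₀, …, Hₙ₋₁ with Hᵢ : 𝒞ᵢ ⇒ Set, and
  -- Base sends such a list to 𝒞ₙ; the two are defined by induction-recursion.
  data SortSignature : ℕ → Set (lsuc ℓ)
  Base : ∀ {n} → SortSignature n → Precategory (lsuc ℓ) ℓ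

  data SortSignature where
    []  : SortSignature zero
    _▷_ : ∀ {n} (S : SortSignature n) → Functor (Base S) (Sets ℓ) → SortSignature (suc n)

  Base []      = Terminal
  Base (S ▷ H) = Extend (Base S) H

{-# OPTIONS --safe #-}

-- Limits in 𝒞ᵢ₊₁ are computed from limits in 𝒞ᵢ.  Given a diagram i ↦ (Xᵢ , Pᵢ),
-- take the limit X of the Xᵢ with projections πᵢ, and over x : H X put the set of
-- families pᵢ : Pᵢ (H πᵢ x) compatible with the action of the diagram.  H need not
-- preserve limits: everything happens fibrewise over a fixed x.

module Submission where

open import Defs
open import Level using (Level) renaming (suc to lsuc)
open import Data.Nat.Base using (ℕ)
open import Axiom.Extensionality.Propositional using (Extensionality)
open import Data.Product.Base using (Σ-syntax; _,_; proj₁; proj₂)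
open import Data.Unit.Polymorphic.Base using (tt)
open import Relation.Binary.PropositionalEquality using (_≡_; refl; sym; trans; cong; cong-app; subst)
open import Relation.Binary.HeterogeneousEquality as HEq using (_≅_; ≡-to-≅; ≅-to-≡)

Terminal-hasLimits : ∀ {o h} (ℓ : Level) → HasLimitsOfSize ℓ (Terminal {o} {h})
Terminal-hasLimits ℓ I D = record
  { cone    = record { apex = tt ; π = λ _ → tt ; commute = λ _ → refl }
  ; mediate = λ _ → tt
  ; factor  = λ _ _ → refl
  ; unique  = λ _ _ _ → refl
  }

module _ {ℓ : Level} (fe : Extensionality ℓ ℓ)
         (C : Precategory (lsuc ℓ) ℓ) (H : Functor C (Sets ℓ)) where
  private
    module E = Precategory (Extend fe C H)
    open Functor H renaming (F₁ to H₁; F-∘ to H-∘)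

  Extend-forget : Functor (Extend fe C H) C
  Extend-forget = record { F₀ = proj₁ ; F₁ = proj₁ ; F-id = refl ; F-∘ = λ _ _ → refl }

  -- Converse direction to `ExtHom-≡`: an equation of morphisms is read off on fibres. The two
  -- values lie over `H₁` of different base morphisms, hence the heterogeneous equality.
  Hom-≡⇒≅ : (A B : E.Obj) {f g : E.Hom A B} → f ≡ g →
            ∀ x p → proj₂ f x p ≅ proj₂ g x p
  Hom-≡⇒≅ A B refl x p = HEq.refl

  -- The second component of a composite is a transport along `H-∘`, which heterogeneous equality
  -- absorbs.
  ∘-action : (A B G : E.Obj) (g : E.Hom B G) (f : E.Hom A B) → ∀ x p →
             proj₂ (E._∘_ {A} {B} {G} g f) x p ≅ proj₂ g (H₁ (proj₁ f) x) (proj₂ f x p)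
  ∘-action A B G (g , _) (f , _) x p =
    HEq.≡-subst-removable (proj₂ G) (sym (cong-app (H-∘ f g) x)) _

module _ {o h o′ h′ o″ h″ : Level} {I : Precategory o h} {C : Precategory o′ h′}
         {D : Precategory o″ h″} (G : Functor C D) (F : Functor I C) where
  private
    module G = Functor G
    module F = Functor F

  infixr 9 _∘F_
  _∘F_ : Functor I D
  _∘F_ = record
    { F₀   = λ i → G.F₀ (F.F₀ i)
    ; F₁   = λ a → G.F₁ (F.F₁ a)
    ; F-id = trans (cong G.F₁ F.F-id) G.F-id
    ; F-∘  = λ a b → trans (cong G.F₁ (F.F-∘ a b)) (G.F-∘ (F.F₁ a) (F.F₁ b))
    }

  -- Used with the forgetful functor, to turn a cone over `D` into one to which the limit `L` in the
  -- base applies.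
  mapCone : Cone F → Cone _∘F_
  mapCone K = record
    { apex    = G.F₀ K.apex
    ; π       = λ i → G.F₁ (K.π i)
    ; commute = λ {i} a → trans (sym (G.F-∘ (K.π i) (F.F₁ a))) (cong G.F₁ (K.commute a))
    }
    where module K = Cone K

module _ {ℓ : Level} (fe : Extensionality ℓ ℓ)
         (C : Precategory (lsuc ℓ) ℓ) (H : Functor C (Sets ℓ))
         {I : Precategory ℓ ℓ} (D : Functor I (Extend fe C H))
         (L : Limit (Extend-forget fe C H ∘F D)) where
  private
    module C = Precategory C
    module E = Precategory (Extend fe C H)
    module I = Precategory I
    module D = Functor D
    module L = Limit L
    open Functor H renaming (F₀ to H₀; F₁ to H₁; F-∘ to H-∘)

    P : (i : I.Obj) → H₀ (proj₁ (D.F₀ i)) → Set ℓ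
    P i = proj₂ (D.F₀ i)

    act : ∀ {i j} (a : I.Hom i j) (x : H₀ (proj₁ (D.F₀ i))) → P i x → P j (H₁ (proj₁ (D.F₁ a)) x)
    act a = proj₂ (D.F₁ a)

  Family : H₀ L.apex → Set ℓ
  Family x = (i : I.Obj) → P i (H₁ (L.π i) x)

  -- The two sides live over H (D a) (H πᵢ x) and H πⱼ x, which agree only
  -- propositionally; heterogeneous equality avoids transports.
  Compatible : (x : H₀ L.apex) → Family x → Set ℓ
  Compatible x p = ∀ i j (a : I.Hom i j) → act a (H₁ (L.π i) x) (p i) ≅ p j

  CompatibleFamily : H₀ L.apex → Set ℓ
  CompatibleFamily x = Σ[ p ∈ Family x ] Compatible x p

  -- Axiom K makes each heterogeneous equation a proposition, and `fe` lifts this through the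
  -- quantifiers. Hence compatible families are determined by their components.
  Compatible-irrelevant : ∀ {x p} (c d : Compatible x p) → c ≡ d
  Compatible-irrelevant c d =
    fe λ i → fe λ j → fe λ a → HEq.≅-irrelevant (c i j a) (d i j a)

  CompatibleFamily-≡ : ∀ {x} {p q : CompatibleFamily x} →
                       (∀ i → proj₁ p i ≡ proj₁ q i) → p ≡ q
  CompatibleFamily-≡ {p = p , c} {q , d} e with refl ← fe {f = p} {g = q} e =
    cong (p ,_) (Compatible-irrelevant c d)

  Extend-apex : E.Obj
  Extend-apex = L.apex , CompatibleFamily

  Extend-π : (i : I.Obj) → E.Hom Extend-apex (D.F₀ i)
  Extend-π i = L.π i , λ x p → proj₁ p i

  Extend-cone : Cone D
  Extend-cone = record
    { apex    = Extend-apex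
    ; π       = Extend-π
    ; commute = λ {i} {j} a →
        ExtHom-≡ fe C H {Extend-apex} {D.F₀ j} (L.commute a) λ x p →
          HEq.trans (∘-action fe C H Extend-apex (D.F₀ i) (D.F₀ j) (D.F₁ a) (Extend-π i) x p)
                    -- On fibres, commutativity of the cone is exactly the compatibility carried by
                    -- `p`.
                    (proj₂ p i j a)
    }

  module _ (K : Cone D) where
    private
      module K = Cone K

      K₀ : Cone (Extend-forget fe C H ∘F D)
      K₀ = mapCone (Extend-forget fe C H) D K

      m : C.Hom (proj₁ K.apex) L.apex
      m = L.mediate K₀

    -- The legs of `K` take values over the left-hand point, while a family over `H₁ m x` must have
    -- values over the right-hand one. The factorisation through `L` and functoriality of `H` link
    -- the two.
    H-factor : ∀ i x → H₁ (proj₁ (K.π i)) x ≡ H₁ (L.π i) (H₁ m x)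
    H-factor i x = trans (cong (λ f → H₁ f x) (sym (L.factor K₀ i))) (cong-app (H-∘ m (L.π i)) x)

    mediate-family : ∀ x → proj₂ K.apex x → Family (H₁ m x)
    mediate-family x p i = subst (P i) (H-factor i x) (proj₂ (K.π i) x p)

    mediate-family-≅ : ∀ x p i → mediate-family x p i ≅ proj₂ (K.π i) x p
    mediate-family-≅ x p i = HEq.≡-subst-removable (P i) (H-factor i x) _

    -- Once the transports are stripped at `i` and `j`, what remains is commutativity of `K` on
    -- second components.
    mediate-compatible : ∀ x p → Compatible (H₁ m x) (mediate-family x p)
    mediate-compatible x p i j a = begin
      act a (H₁ (L.π i) (H₁ m x)) (mediate-family x p i)
        -- The base point is itself an argument of `act a`, so point and element are replaced
        -- together.
        ≅⟨ HEq.cong₂ (act a) (≡-to-≅ (sym (H-factor i x))) (mediate-family-≅ x p i) ⟩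
      act a (H₁ (proj₁ (K.π i)) x) (proj₂ (K.π i) x p)
        ≅⟨ ∘-action fe C H K.apex (D.F₀ i) (D.F₀ j) (D.F₁ a) (K.π i) x p ⟨
      proj₂ (E._∘_ {K.apex} {D.F₀ i} {D.F₀ j} (D.F₁ a) (K.π i)) x p
        ≅⟨ Hom-≡⇒≅ fe C H K.apex (D.F₀ j) (K.commute a) x p ⟩
      proj₂ (K.π j) x p
        ≅⟨ mediate-family-≅ x p j ⟨
      mediate-family x p j ∎
      where open HEq.≅-Reasoning

    Extend-mediate : E.Hom K.apex Extend-apex
    Extend-mediate = m , λ x p → mediate-family x p , mediate-compatible x p

    Extend-factor : ∀ i → E._∘_ {K.apex} {Extend-apex} {D.F₀ i} (Extend-π i) Extend-mediate ≡ K.π i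
    Extend-factor i = ExtHom-≡ fe C H {K.apex} {D.F₀ i} (L.factor K₀ i) λ x p →
      HEq.trans (∘-action fe C H K.apex Extend-apex (D.F₀ i) (Extend-π i) Extend-mediate x p)
                (mediate-family-≅ x p i)

    Extend-unique : (u : E.Hom K.apex Extend-apex) →
                    (∀ i → E._∘_ {K.apex} {Extend-apex} {D.F₀ i} (Extend-π i) u ≡ K.π i) →
                    u ≡ Extend-mediate
    -- Uniqueness in the base identifies `u₀` with `m`. Both second components then land in the same
    -- fibre over `H₁ m x`, and can be compared by ordinary equality, one index at a time.
    Extend-unique u@(u₀ , _) e with refl ← L.unique K₀ u₀ (λ i → cong proj₁ (e i)) =
      ExtHom-≡ fe C H {K.apex} {Extend-apex} refl λ x p →
        ≡-to-≅ (CompatibleFamily-≡ λ i → ≅-to-≡ (component x p i))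
      where
      open HEq.≅-Reasoning

      component : ∀ x p i → proj₁ (proj₂ u x p) i ≅ mediate-family x p i
      component x p i = begin
        proj₁ (proj₂ u x p) i
          ≅⟨ ∘-action fe C H K.apex Extend-apex (D.F₀ i) (Extend-π i) u x p ⟨
        proj₂ (E._∘_ {K.apex} {Extend-apex} {D.F₀ i} (Extend-π i) u) x p
          ≅⟨ Hom-≡⇒≅ fe C H K.apex (D.F₀ i) (e i) x p ⟩
        proj₂ (K.π i) x p
          ≅⟨ mediate-family-≅ x p i ⟨
        mediate-family x p i ∎

  Extend-limit : Limit D
  Extend-limit = record
    { cone    = Extend-cone
    ; mediate = Extend-mediate
    ; factor  = Extend-factor
    ; unique  = Extend-unique
    }

Extend-hasLimits : {ℓ : Level} (fe : Extensionality ℓ ℓ)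
                   (C : Precategory (lsuc ℓ) ℓ) (H : Functor C (Sets ℓ)) →
                   HasLimitsOfSize ℓ C → HasLimitsOfSize ℓ (Extend fe C H)
Extend-hasLimits fe C H lim I D = Extend-limit fe C H D (lim I (Extend-forget fe C H ∘F D))

mainTheorem1 : {ℓ : Level} (fe : Extensionality ℓ ℓ) (n : ℕ) (S : SortSignature fe n) → HasLimitsOfSize ℓ (Base fe S)
mainTheorem1 {ℓ} fe _ []            = Terminal-hasLimits ℓ
mainTheorem1     fe _ (_▷_ {n} S H) = Extend-hasLimits fe (Base fe S) H (mainTheorem1 fe n S)
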